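{- Let $Q$ be a torsion-free fs monoid and let $P$ be a toric submonoid of $Q$ such that $Q\cap(-P)=\{0\}$ (inside $Q^{\mathrm{gp}}$). Suppose that the inclusion $u:P\hookrightarrow Q$ is pseudo-saturated and that the cokernel of the induced map $u^{\mathrm{gp}}:P^{\mathrm{gp}}\to Q^{\mathrm{gp}}$ is torsion-free. Then there exists a positive integer $m$ such that the canonical homomorphism $$\tfrac1m P\longrightarrow Q\sqcup_P^{\mathrm{sat}}\tfrac1m P$$ is quasi-saturated, where $\sqcup^{\mathrm{sat}}$ denotes the pushout in the category of saturated monoids.
   Context: All monoids are commutative with identity, written additively. $P^{\mathrm{gp}}$ is the group envelope of $P$. $P$ is integral if $P\to P^{\mathrm{gp}}$ is injective; saturated if it is integral and every $a\in P^{\mathrm{gp}}$ with $na\in P$ for some integer $n\ge1$ lies in $P$; fs if it is saturated and finitely generated; sharp if its only unit is $0$; toric if it is sharp and fs. For $x,x'$ in a monoid $P$, write $x\mid x'$ if $x'=x+x''$ for some $x''\in P$. For a saturated torsion-free monoid $P$ and $m\ge1$, $P\hookrightarrow\frac1mP$ denotes the inclusion of saturated torsion-free monoids isomorphic to multiplication by $m$ on $P$. The pushout in saturated monoids is the saturation of the pushout in monoids, where for a monoid $S$ the saturation is $\{a\in S^{\mathrm{gp}} : na\in \mathrm{im}(S\to S^{\mathrm{gp}})\text{ for some } n\ge1\}$. A homomorphism $u:P\to Q$ of saturated monoids is pseudo-saturated with conductor $M$ (an integer $M\ge1$) if for every integer $n\ge1$ and all $x\in P$, $y\in Q$ with $u(x)\mid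 ny$ in $Q$, there exists $x'\in P$ with $Mx\mid nx'$ in $P$ and $u(x')\mid My$ in $Q$. It is pseudo-saturated if it is so for some $M\ge1$. It is quasi-saturated (in the sense of Tsuji) if it is pseudo-saturated with conductor $1$, i.e. for all $n\ge1$, $x\in P$, $y\in Q$ with $u(x)\mid ny$ there is $x'\in P$ with $x\mid nx'$ and $u(x')\mid y$ (for saturated monoids this is equivalent to Tsuji's original definition). -}

module Defs where

open import Level using (Level; _⊔_)
open import Data.Nat.Base using (ℕ; suc; _≤_)
import Data.Nat.Base as ℕ
import Data.Nat.Properties as ℕₚ
open import Data.Fin.Base using (Fin)
open import Data.Fin using (#_)
open import Data.Vec.Base using ([]; _∷_)
open import Data.Product.Base using (Σ; ∃-syntax; _×_; _,_; proj₁; proj₂)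
open import Function.Definitions using (Injective)
open import Relation.Binary.Core using (Rel)
open import Algebra.Bundles using (CommutativeMonoid; AbelianGroup)
open import Algebra.Morphism.Bundles using (MonoidHomomorphism; GroupHomomorphism)
import Algebra.Construct.DirectProduct as DirectProduct
import Algebra.Definitions.RawMonoid as RawMonoidDefinitions
import Algebra.Properties.AbelianGroup as AbelianGroupProperties
import Algebra.Properties.CommutativeMonoid.Mult as Mult
import Algebra.Solver.CommutativeMonoid as Solver

private
  variable
    c ℓ c₁ ℓ₁ c₂ ℓ₂ c₃ ℓ₃ : Level

-- The library writes the operation of a commutative
-- monoid as _∙_ with identity ε; here it plays the role of addition.

Hom : CommutativeMonoid c₁ ℓ₁ → CommutativeMonoid c₂ ℓ₂ → Set (c₁ ⊔ ℓ₁ ⊔ c₂ ⊔ ℓ₂)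
Hom P Q = MonoidHomomorphism (CommutativeMonoid.rawMonoid P) (CommutativeMonoid.rawMonoid Q)

module _ (P : CommutativeMonoid c ℓ) where
  open CommutativeMonoid P
  open Solver P using (Expr; prove; var; _⊕_)

  private
    v₀ : Expr 6
    v₀ = var (# 0)
    v₁ : Expr 6
    v₁ = var (# 1)
    v₂ : Expr 6
    v₂ = var (# 2)
    v₃ : Expr 6
    v₃ = var (# 3)
    v₄ : Expr 6
    v₄ = var (# 4)
    v₅ : Expr 6
    v₅ = var (# 5)

    GpCarrier : Set c
    GpCarrier = Carrier × Carrier

    _≈ᵍ_ : Rel GpCarrier (c ⊔ ℓ)
    (a , b) ≈ᵍ (a′ , b′) = ∃[ k ] (a ∙ b′) ∙ k ≈ (a′ ∙ b) ∙ k

    _+ᵍ_ : GpCarrier → GpCarrier → GpCarrier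
    (a , b) +ᵍ (a′ , b′) = a ∙ a′ , b ∙ b′

    ≈ᵍ-trans : ∀ {x y z} → x ≈ᵍ y → y ≈ᵍ z → x ≈ᵍ z
    ≈ᵍ-trans {a , b} {a′ , b′} {a″ , b″} (k , p) (l , q) =
      (a′ ∙ b′) ∙ (k ∙ l) ,
      trans (regroup a b″ b′ a′ k l)
        (trans (∙-cong p q)
          (trans (comm _ _)
            (trans (sym (regroup a″ b b′ a′ l k))
              (∙-congˡ (∙-cong refl (comm l k))))))
      where
      regroup : ∀ x y z w k l →
        (x ∙ y) ∙ ((w ∙ z) ∙ (k ∙ l)) ≈ ((x ∙ z) ∙ k) ∙ ((w ∙ y) ∙ l)
      regroup x y z w k l =
        prove 6 ((v₀ ⊕ v₁) ⊕ ((v₃ ⊕ v₂) ⊕ (v₄ ⊕ v₅)))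
                (((v₀ ⊕ v₂) ⊕ v₄) ⊕ ((v₃ ⊕ v₁) ⊕ v₅))
                (x ∷ y ∷ z ∷ w ∷ k ∷ l ∷ [])

    +ᵍ-cong : ∀ {x x′ y y′} → x ≈ᵍ x′ → y ≈ᵍ y′ → (x +ᵍ y) ≈ᵍ (x′ +ᵍ y′)
    +ᵍ-cong {a , b} {a′ , b′} {d , e} {d′ , e′} (k , p) (l , q) =
      k ∙ l ,
      trans (shuffle a d b′ e′ k l)
        (trans (∙-cong p q) (sym (shuffle a′ d′ b e k l)))
      where
      shuffle : ∀ x y z w k l →
        ((x ∙ y) ∙ (z ∙ w)) ∙ (k ∙ l) ≈ ((x ∙ z) ∙ k) ∙ ((y ∙ w) ∙ l)
      shuffle x y z w k l =
        prove 6 (((v₀ ⊕ v₁) ⊕ (v₂ ⊕ v₃)) ⊕ (v₄ ⊕ v₅))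
                (((v₀ ⊕ v₂) ⊕ v₄) ⊕ ((v₁ ⊕ v₃) ⊕ v₅))
                (x ∷ y ∷ z ∷ w ∷ k ∷ l ∷ [])

    pointwise : ∀ {a a′ b b′} → a ≈ a′ → b ≈ b′ → (a , b) ≈ᵍ (a′ , b′)
    pointwise p q = ε , ∙-congʳ (∙-cong p (sym q))

  -- The group envelope: formal differences (a , b) = "a − b", with
  -- a − b = a′ − b′ iff a + b′ + k = a′ + b + k for some k.
  groupEnvelope : AbelianGroup c (c ⊔ ℓ)
  groupEnvelope = record
    { Carrier = GpCarrier
    ; _≈_ = _≈ᵍ_
    ; _∙_ = _+ᵍ_
    ; ε = ε , ε
    ; _⁻¹ = λ (a , b) → b , a
    ; isAbelianGroup = record
      { isGroup = record
        { isMonoid = record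
          { isSemigroup = record
            { isMagma = record
              { isEquivalence = record
                { refl = ε , refl
                ; sym = λ (k , p) → k , sym p
                ; trans = ≈ᵍ-trans
                }
              ; ∙-cong = +ᵍ-cong
              }
            ; assoc = λ (a , b) (a′ , b′) (a″ , b″) →
                pointwise (assoc a a′ a″) (assoc b b′ b″)
            }
          ; identity = (λ (a , b) → pointwise (identityˡ a) (identityˡ b))
                     , (λ (a , b) → pointwise (identityʳ a) (identityʳ b))
          }
        ; inverse = (λ (a , b) → ε , ∙-congʳ (inv b a))
                  , (λ (a , b) → ε , ∙-congʳ (inv a b))
        ; ⁻¹-cong = λ (k , p) → k , trans (∙-congʳ (comm _ _)) (trans (sym p) (∙-congʳ (comm _ _)))
        }
      ; comm = λ (a , b) (a′ , b′) → pointwise (comm a a′) (comm b b′)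
      }
    }
    where
    inv : ∀ a b → (a ∙ b) ∙ ε ≈ ε ∙ (b ∙ a)
    inv a b = trans (identityʳ _) (trans (comm a b) (sym (identityˡ _)))

_ᵍᵖ : CommutativeMonoid c ℓ → AbelianGroup c (c ⊔ ℓ)
P ᵍᵖ = groupEnvelope P

toGp : (P : CommutativeMonoid c ℓ) → Hom P (AbelianGroup.commutativeMonoid (P ᵍᵖ))
toGp P = record
  { ⟦_⟧ = λ a → a , ε
  ; isMonoidHomomorphism = record
    { isMagmaHomomorphism = record
      { isRelHomomorphism = record { cong = λ p → ε , ∙-congʳ (∙-congʳ p) }
      ; homo = λ a b → ε , ∙-congʳ (∙-congˡ (identityˡ ε))
      }
    ; ε-homo = ε , refl
    }
  }
  where open CommutativeMonoid P

gpMap : (P : CommutativeMonoid c₁ ℓ₁) (Q : CommutativeMonoid c₂ ℓ₂) → Hom P Q →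
        GroupHomomorphism (AbelianGroup.rawGroup (P ᵍᵖ)) (AbelianGroup.rawGroup (Q ᵍᵖ))
gpMap P Q u = record
  { ⟦_⟧ = λ (a , b) → u.⟦ a ⟧ , u.⟦ b ⟧
  ; isGroupHomomorphism = record
    { isMonoidHomomorphism = record
      { isMagmaHomomorphism = record
        { isRelHomomorphism = record
          { cong = λ (k , p) → u.⟦ k ⟧ , trans (sym (homo₃ _ _ k)) (trans (u.⟦⟧-cong p) (homo₃ _ _ k)) }
        ; homo = λ (a , b) (a′ , b′) →
            ε , ∙-congʳ (∙-cong (u.homo a a′) (sym (u.homo b b′)))
        }
      ; ε-homo = ε , ∙-congʳ (trans (identityʳ _) (sym (identityˡ _)))
      }
    ; ⁻¹-homo = λ _ → ε , refl
    }
  }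
  where
  open CommutativeMonoid Q
  module P = CommutativeMonoid P
  module u = MonoidHomomorphism u
  homo₃ : ∀ a b k → u.⟦ (a P.∙ b) P.∙ k ⟧ ≈ (u.⟦ a ⟧ ∙ u.⟦ b ⟧) ∙ u.⟦ k ⟧
  homo₃ a b k = trans (u.homo _ k) (∙-congʳ (u.homo a b))

-- The quotient of H by the image of f: the carrier of H, with h and h′
-- identified when h = h′ + f g for some g.
cokernel : (G : AbelianGroup c₁ ℓ₁) (H : AbelianGroup c₂ ℓ₂) →
           GroupHomomorphism (AbelianGroup.rawGroup G) (AbelianGroup.rawGroup H) →
           AbelianGroup c₂ (c₁ ⊔ ℓ₂)
cokernel G H f = record
  { Carrier = Carrier
  ; _≈_ = λ h h′ → ∃[ g ] h ≈ h′ ∙ f.⟦ g ⟧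
  ; _∙_ = _∙_
  ; ε = ε
  ; _⁻¹ = _⁻¹
  ; isAbelianGroup = record
    { isGroup = record
      { isMonoid = record
        { isSemigroup = record
          { isMagma = record
            { isEquivalence = record
              { refl = lift refl
              ; sym = λ (g , p) → g G.⁻¹ , moveRight p
              ; trans = λ (g , p) (g′ , p′) → g′ G.∙ g ,
                  trans p (trans (∙-congʳ p′)
                    (trans (assoc _ _ _) (∙-congˡ (sym (f.homo g′ g)))))
              }
            ; ∙-cong = λ (g , p) (g′ , p′) → g G.∙ g′ ,
                trans (∙-cong p p′)
                  (trans (interchange _ _ _ _) (∙-congˡ (sym (f.homo g g′))))
            }
          ; assoc = λ x y z → lift (assoc x y z)
          }
        ; identity = (λ x → lift (identityˡ x)) , (λ x → lift (identityʳ x))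
        }
      ; inverse = (λ x → lift (inverseˡ x)) , (λ x → lift (inverseʳ x))
      ; ⁻¹-cong = λ (g , p) → g G.⁻¹ ,
          trans (⁻¹-cong p)
            (trans (sym (⁻¹-∙-comm _ _)) (∙-congˡ (sym (f.⁻¹-homo g))))
      }
    ; comm = λ x y → lift (comm x y)
    }
  }
  where
  module G = AbelianGroup G
  module f = GroupHomomorphism f
  open AbelianGroup H
  open AbelianGroupProperties H using (⁻¹-∙-comm)
  open import Algebra.Properties.CommutativeSemigroup commutativeSemigroup using (interchange)
  lift : ∀ {x y} → x ≈ y → ∃[ g ] x ≈ y ∙ f.⟦ g ⟧
  lift p = G.ε , trans p (trans (sym (identityʳ _)) (∙-congˡ (sym f.ε-homo)))
  moveRight : ∀ {x y g} → x ≈ y ∙ f.⟦ g ⟧ → y ≈ x ∙ f.⟦ g G.⁻¹ ⟧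
  moveRight {x} {y} {g} p = sym
    (trans (∙-cong p (f.⁻¹-homo g))
      (trans (assoc _ _ _) (trans (∙-congˡ (inverseʳ _)) (identityʳ y))))

TorsionFreeGroup : AbelianGroup c ℓ → Set (c ⊔ ℓ)
TorsionFreeGroup G = ∀ n → 1 ≤ n → ∀ a → n · a ≈ ε → a ≈ ε
  where
  open AbelianGroup G
  open RawMonoidDefinitions rawMonoid renaming (_×_ to _·_)

module _ (P : CommutativeMonoid c ℓ) where
  open CommutativeMonoid P
  open RawMonoidDefinitions rawMonoid using (sum) renaming (_×_ to _·_)
  private
    module Gp = AbelianGroup (P ᵍᵖ)
    open RawMonoidDefinitions Gp.rawMonoid using () renaming (_×_ to _·ᵍ_)
    open MonoidHomomorphism (toGp P) using () renaming (⟦_⟧ to ι)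

  InSaturation : Gp.Carrier → Set (c ⊔ ℓ)
  InSaturation a = ∃[ n ] 1 ≤ n × ∃[ s ] n ·ᵍ a Gp.≈ ι s

  TorsionFree : Set (c ⊔ ℓ)
  TorsionFree = TorsionFreeGroup (P ᵍᵖ)

  Integral : Set (c ⊔ ℓ)
  Integral = Injective _≈_ Gp._≈_ ι

  record Saturated : Set (c ⊔ ℓ) where
    field
      integral  : Integral
      saturated : ∀ a → InSaturation a → ∃[ p ] a Gp.≈ ι p

  FinitelyGenerated : Set (c ⊔ ℓ)
  FinitelyGenerated =
    ∃[ k ] Σ (Fin k → Carrier) λ g →
    ∀ x → Σ (Fin k → ℕ) λ e → x ≈ sum (λ i → e i · g i)

  record Fs : Set (c ⊔ ℓ) where
    field
      isSaturated       : Saturated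
      finitelyGenerated : FinitelyGenerated

  Sharp : Set (c ⊔ ℓ)
  Sharp = ∀ x y → x ∙ y ≈ ε → x ≈ ε

  record Toric : Set (c ⊔ ℓ) where
    field
      sharp : Sharp
      fs    : Fs

  private
    ∙ᵍ-closed : ∀ {a b} → InSaturation a → InSaturation b → InSaturation (a Gp.∙ b)
    ∙ᵍ-closed {a} {b} (m , 1≤m , s , p) (n , 1≤n , t , q) =
      m ℕ.* n , ℕₚ.*-mono-≤ 1≤m 1≤n , (n · s) ∙ (m · t) ,
      Gp.trans (M.×-distrib-+ a b (m ℕ.* n))
        (Gp.trans
          (Gp.∙-cong
            (Gp.trans (M.×-congˡ (ℕₚ.*-comm m n))
              (Gp.trans (Gp.sym (M.×-assocˡ a n m))
                (Gp.trans (M.×-congʳ n p) (ι-· n s))))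
            (Gp.trans (Gp.sym (M.×-assocˡ b m n))
              (Gp.trans (M.×-congʳ m q) (ι-· m t))))
          (Gp.sym (MonoidHomomorphism.homo (toGp P) (n · s) (m · t))))
      where
      module M = Mult Gp.commutativeMonoid
      ι-· : ∀ k x → (k ·ᵍ ι x) Gp.≈ ι (k · x)
      ι-· ℕ.zero  x = Gp.refl
      ι-· (suc k) x = Gp.trans (Gp.∙-congˡ {ι x} (ι-· k x))
                        (Gp.sym (MonoidHomomorphism.homo (toGp P) x (k · x)))

  saturation : CommutativeMonoid (c ⊔ ℓ) (c ⊔ ℓ)
  saturation = record
    { Carrier = Σ Gp.Carrier InSaturation
    ; _≈_ = λ a b → proj₁ a Gp.≈ proj₁ b
    ; _∙_ = λ (a , p) (b , q) → a Gp.∙ b , ∙ᵍ-closed p q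
    ; ε = Gp.ε , 1 , ℕₚ.≤-refl , ε , Gp.identityʳ Gp.ε
    ; isCommutativeMonoid = record
      { isMonoid = record
        { isSemigroup = record
          { isMagma = record
            { isEquivalence = record { refl = Gp.refl ; sym = Gp.sym ; trans = Gp.trans }
            ; ∙-cong = Gp.∙-cong
            }
          ; assoc = λ a b d → Gp.assoc (proj₁ a) (proj₁ b) (proj₁ d)
          }
        ; identity = (λ a → Gp.identityˡ (proj₁ a)) , (λ a → Gp.identityʳ (proj₁ a))
        }
      ; comm = λ a b → Gp.comm (proj₁ a) (proj₁ b)
      }
    }

  toSaturation : Hom P saturation
  toSaturation = record
    { ⟦_⟧ = λ a → ι a , 1 , ℕₚ.≤-refl , a , Gp.identityʳ (ι a)
    ; isMonoidHomomorphism = record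
      { isMagmaHomomorphism = record
        { isRelHomomorphism = record { cong = MonoidHomomorphism.⟦⟧-cong (toGp P) }
        ; homo = MonoidHomomorphism.homo (toGp P)
        }
      ; ε-homo = MonoidHomomorphism.ε-homo (toGp P)
      }
    }

module _ (P : CommutativeMonoid c₁ ℓ₁) (Q : CommutativeMonoid c₂ ℓ₂)
         (N : CommutativeMonoid c₃ ℓ₃) (u : Hom P Q) (v : Hom P N) where
  private
    module P = CommutativeMonoid P
    module Q = CommutativeMonoid Q
    module N = CommutativeMonoid N
    module Q×N = CommutativeMonoid (DirectProduct.commutativeMonoid Q N)
    module u = MonoidHomomorphism u
    module v = MonoidHomomorphism v

  -- The direct product of commutative monoids is their coproduct, so the
  -- pushout is its quotient by the least congruence identifying
  -- (u p , 0) with (0 , v p) for every p.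
  data PushoutEq : Rel Q×N.Carrier (c₁ ⊔ c₂ ⊔ ℓ₂ ⊔ c₃ ⊔ ℓ₃) where
    incl   : ∀ {x y} → x Q×N.≈ y → PushoutEq x y
    glue   : ∀ p → PushoutEq (u.⟦ p ⟧ , N.ε) (Q.ε , v.⟦ p ⟧)
    symᵖ   : ∀ {x y} → PushoutEq x y → PushoutEq y x
    transᵖ : ∀ {x y z} → PushoutEq x y → PushoutEq y z → PushoutEq x z
    congᵖ  : ∀ {x x′ y y′} → PushoutEq x x′ → PushoutEq y y′ →
             PushoutEq (x Q×N.∙ y) (x′ Q×N.∙ y′)

  pushout : CommutativeMonoid (c₂ ⊔ c₃) (c₁ ⊔ c₂ ⊔ ℓ₂ ⊔ c₃ ⊔ ℓ₃)
  pushout = record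
    { Carrier = Q×N.Carrier
    ; _≈_ = PushoutEq
    ; _∙_ = Q×N._∙_
    ; ε = Q×N.ε
    ; isCommutativeMonoid = record
      { isMonoid = record
        { isSemigroup = record
          { isMagma = record
            { isEquivalence = record { refl = incl Q×N.refl ; sym = symᵖ ; trans = transᵖ }
            ; ∙-cong = congᵖ
            }
          ; assoc = λ x y z → incl (Q×N.assoc x y z)
          }
        ; identity = (λ x → incl (Q×N.identityˡ x)) , (λ x → incl (Q×N.identityʳ x))
        }
      ; comm = λ x y → incl (Q×N.comm x y)
      }
    }

  pushoutInjʳ : Hom N pushout
  pushoutInjʳ = record
    { ⟦_⟧ = λ n → Q.ε , n
    ; isMonoidHomomorphism = record
      { isMagmaHomomorphism = record
        { isRelHomomorphism = record { cong = λ p → incl (Q.refl , p) }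
        ; homo = λ _ _ → incl (Q.sym (Q.identityˡ Q.ε) , N.refl)
        }
      ; ε-homo = incl Q×N.refl
      }
    }

  satPushout : CommutativeMonoid (c₁ ⊔ c₂ ⊔ ℓ₂ ⊔ c₃ ⊔ ℓ₃) (c₁ ⊔ c₂ ⊔ ℓ₂ ⊔ c₃ ⊔ ℓ₃)
  satPushout = saturation pushout

  satPushoutInjʳ : Hom N satPushout
  satPushoutInjʳ = record
    { ⟦_⟧ = λ n → σ.⟦ j.⟦ n ⟧ ⟧
    ; isMonoidHomomorphism = record
      { isMagmaHomomorphism = record
        { isRelHomomorphism = record { cong = λ p → σ.⟦⟧-cong (j.⟦⟧-cong p) }
        ; homo = λ x y → S.trans {σ.⟦ j.⟦ x N.∙ y ⟧ ⟧} {σ.⟦ j.⟦ x ⟧ Q×N.∙ j.⟦ y ⟧ ⟧}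
                           {σ.⟦ j.⟦ x ⟧ ⟧ S.∙ σ.⟦ j.⟦ y ⟧ ⟧}
                           (σ.⟦⟧-cong (j.homo x y)) (σ.homo j.⟦ x ⟧ j.⟦ y ⟧)
        }
      ; ε-homo = σ.ε-homo
      }
    }
    where
    module S = CommutativeMonoid satPushout
    module σ = MonoidHomomorphism (toSaturation pushout)
    module j = MonoidHomomorphism pushoutInjʳ

-- The inclusion P ↪ (1/m)P is by definition (isomorphic to) multiplication by
-- m on P.  So (1/m)P is a copy of P whose element p stands for p/m, and the
-- element p of P is sent to (mp)/m.

1/_∙_ : ℕ → CommutativeMonoid c ℓ → CommutativeMonoid c ℓ
1/ m ∙ P = P

toFraction : (m : ℕ) (P : CommutativeMonoid c ℓ) → Hom P (1/ m ∙ P)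
toFraction m P = record
  { ⟦_⟧ = λ p → m · p
  ; isMonoidHomomorphism = record
    { isMagmaHomomorphism = record
      { isRelHomomorphism = record { cong = ×-congʳ m }
      ; homo = λ x y → ×-distrib-+ x y m
      }
    ; ε-homo = ×-ε m
    }
  }
  where
  open CommutativeMonoid P
  open Mult P using (×-congʳ; ×-distrib-+) renaming (_×_ to _·_)
  ×-ε : ∀ n → n · ε ≈ ε
  ×-ε ℕ.zero  = refl
  ×-ε (suc n) = trans (identityˡ _) (×-ε n)

module _ (P : CommutativeMonoid c₁ ℓ₁) (Q : CommutativeMonoid c₂ ℓ₂) (u : Hom P Q) where
  private
    module P = CommutativeMonoid P
    module Q = CommutativeMonoid Q
    module u = MonoidHomomorphism u
    open RawMonoidDefinitions P.rawMonoid using ()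
      renaming (_×_ to _·ᴾ_; _∣ˡ_ to _∣ᴾ_)
    open RawMonoidDefinitions Q.rawMonoid using ()
      renaming (_×_ to _·ꟴ_; _∣ˡ_ to _∣ꟴ_)

  HasConductor : ℕ → Set (c₁ ⊔ ℓ₁ ⊔ c₂ ⊔ ℓ₂)
  HasConductor M =
    ∀ n → 1 ≤ n → ∀ x y → u.⟦ x ⟧ ∣ꟴ (n ·ꟴ y) →
    ∃[ x′ ] (M ·ᴾ x) ∣ᴾ (n ·ᴾ x′) × u.⟦ x′ ⟧ ∣ꟴ (M ·ꟴ y)

  PseudoSaturated : Set (c₁ ⊔ ℓ₁ ⊔ c₂ ⊔ ℓ₂)
  PseudoSaturated = ∃[ M ] 1 ≤ M × HasConductor M

  QuasiSaturated : Set (c₁ ⊔ ℓ₁ ⊔ c₂ ⊔ ℓ₂)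
  QuasiSaturated = HasConductor 1

  -- Q ∩ (−P) = {0} inside Qᵍᵖ; the inclusion ⊇ always holds.
  MeetsNegativeTrivially : Set (c₁ ⊔ c₂ ⊔ ℓ₂)
  MeetsNegativeTrivially =
    ∀ a → (∃[ q ] a Gp.≈ ι q) → (∃[ p ] a Gp.≈ (ι u.⟦ p ⟧) Gp.⁻¹) → a Gp.≈ Gp.ε
    where
    module Gp = AbelianGroup (Q ᵍᵖ)
    open MonoidHomomorphism (toGp Q) using () renaming (⟦_⟧ to ι)

{-# OPTIONS --safe #-}
-- The integer m is the conductor M of u.  An element (q, p) of the pushout is
-- the fraction (M q + p)/M, and a formal difference of such fractions lies in
-- the saturation iff the difference of the numerators lies in Q.  Thus, for q
-- in Qᵍᵖ, p in Pᵍᵖ, x in P and n (M q + p) − x in Q, one needs x′ in P with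
-- x ∣ n x′ and M q + p − x′ in Q.  Adding an element of P to q, one may assume
-- that q lies in Q and p = −d with d in P.  Then x + n d ∣ n M q, so the
-- conductor gives z in P with M (x + n d) ∣ n M z and z ∣ M q.  Saturation
-- allows one to cancel M, and x′ = z − d.
module Submission where

open import Level using (Level)
open import Data.Nat.Base using (ℕ; zero; suc; _≤_; z≤n; s≤s)
import Data.Nat.Base as ℕ
import Data.Nat.Properties as ℕₚ
open import Data.Product.Base using (_×_; ∃-syntax; _,_; proj₁; proj₂)
open import Function.Definitions using (Injective)
open import Relation.Binary.PropositionalEquality.Core as ≡ using (_≡_)
import Relation.Binary.Reasoning.Setoid as SetoidReasoning
open import Algebra.Bundles using (CommutativeMonoid; AbelianGroup)
open import Algebra.Morphism.Bundles using (MonoidHomomorphism; GroupHomomorphism)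
open import Algebra.Definitions.RawMagma using (_,_)
import Algebra.Definitions.RawMonoid as RawMonoidDefinitions
import Algebra.Properties.AbelianGroup as AbelianGroupProperties
import Algebra.Properties.CommutativeMonoid.Mult as Mult
import Algebra.Properties.CommutativeSemigroup as CommutativeSemigroupProperties
import Algebra.Solver.CommutativeMonoid as Solver
open import Defs

private
  variable
    c ℓ c₁ ℓ₁ c₂ ℓ₂ : Level

-- Multiples, formal differences and divisibility.

homo-× : (A : CommutativeMonoid c₁ ℓ₁) (B : CommutativeMonoid c₂ ℓ₂) (f : Hom A B) →
  let open MonoidHomomorphism f
      open CommutativeMonoid B
      open RawMonoidDefinitions (CommutativeMonoid.rawMonoid A) using () renaming (_×_ to _·ᴬ_)
      open RawMonoidDefinitions rawMonoid using () renaming (_×_ to _·ᴮ_)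
  in ∀ n x → ⟦ n ·ᴬ x ⟧ ≈ n ·ᴮ ⟦ x ⟧
homo-× A B f zero    x = MonoidHomomorphism.ε-homo f
homo-× A B f (suc n) x = trans (homo x _) (∙-congˡ (homo-× A B f n x))
  where
  open MonoidHomomorphism f
  open CommutativeMonoid B

module _ (P : CommutativeMonoid c ℓ) where
  open CommutativeMonoid P
  open Mult P using (×-congˡ; ×-assocˡ) renaming (_×_ to _·_)
  open RawMonoidDefinitions rawMonoid using (_∣ˡ_)
  private
    module Gp = AbelianGroup (P ᵍᵖ)
    open RawMonoidDefinitions Gp.rawMonoid using () renaming (_×_ to _·ᵍ_)
    open RawMonoidDefinitions (CommutativeMonoid.rawMonoid (saturation P)) using ()
      renaming (_×_ to _·ˢ_)

  ×-pair : ∀ n a b → n ·ᵍ (a , b) ≡ (n · a , n · b)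
  ×-pair zero    a b = ≡.refl
  ×-pair (suc n) a b = ≡.cong ((a , b) Gp.∙_) (×-pair n a b)

  ∣-1× : ∀ a b → a ∣ˡ b → a ∣ˡ (1 · b)
  ∣-1× a b (r , eq) = r , trans eq (sym (identityʳ b))

  saturation-× : ∀ n s → proj₁ (n ·ˢ s) ≡ n ·ᵍ proj₁ s
  saturation-× zero    s = ≡.refl
  saturation-× (suc n) s = ≡.cong (proj₁ s Gp.∙_) (saturation-× n s)

  integral⇒cancelʳ : Integral P → ∀ {a b} k → a ∙ k ≈ b ∙ k → a ≈ b
  integral⇒cancelʳ integral k p =
    integral (k , trans (∙-congʳ (identityʳ _)) (trans p (∙-congʳ (sym (identityʳ _)))))

  integral⇒cross : Integral P → ∀ {a b a′ b′} → (a , b) Gp.≈ (a′ , b′) → a ∙ b′ ≈ a′ ∙ b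
  integral⇒cross integral (k , p) = integral⇒cancelʳ integral k p

  -- Saturatedness makes a - b an element p of `P`; integrality turns a - b = p into b + p = a.
  saturation⇒∣ : Saturated P → ∀ {a b} → InSaturation P (a , b) → b ∣ˡ a
  saturation⇒∣ S {a} {b} s with Saturated.saturated S (a , b) s
  ... | p , eq = p , trans (comm b p)
        (trans (sym (integral⇒cross (Saturated.integral S) eq)) (identityʳ a))

  -- The quotient p equals n a - n b = n (a - b), so n witnesses that a - b is in the saturation.
  ×-cancel-∣ : Saturated P → ∀ {n a b} → 1 ≤ n → (n · b) ∣ˡ (n · a) → b ∣ˡ a
  ×-cancel-∣ S {n} {a} {b} 1≤n (p , eq) = saturation⇒∣ S
    (n , 1≤n , p , ≡.subst (Gp._≈ (p , ε)) (≡.sym (×-pair n a b))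
      (ε , ∙-congʳ (trans (identityʳ _) (trans (sym eq) (comm _ p)))))

  -- Removes the factor that the conductor leaves on both sides when it is applied with multiplier n
  -- M.
  ×-cancel-∣-* : Saturated P → ∀ {m n a b} → 1 ≤ m → (m · b) ∣ˡ ((n ℕ.* m) · a) → b ∣ˡ (n · a)
  ×-cancel-∣-* S {m} {n} {a} 1≤m (p , eq) = ×-cancel-∣ S 1≤m
    (p , trans eq (trans (×-congˡ (ℕₚ.*-comm n m)) (sym (×-assocˡ a m n))))

-- Divisibility arithmetic in saturated monoids.

module _ (P : CommutativeMonoid c ℓ) (SP : Saturated P) where
  open CommutativeMonoid P
  open Mult P using (×-congʳ; ×-distrib-+) renaming (_×_ to _·_)
  open RawMonoidDefinitions rawMonoid using (_∣ˡ_)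
  open Solver P using (solve; _⊜_; _⊕_)

  -- In particular n d ∣ n z, so d ∣ z by saturation; with z = d + x′, cancelling n d leaves x ∣ n
  -- x′.
  ×-subtract : ∀ {n x d z} → 1 ≤ n → (x ∙ n · d) ∣ˡ (n · z) → ∃[ x′ ] d ∙ x′ ≈ z × x ∣ˡ (n · x′)
  ×-subtract {n} {x} {d} {z} 1≤n (e , eq) = subtract
    (×-cancel-∣ P SP 1≤n (x ∙ e ,
      trans (solve 3 (λ x d e → d ⊕ (x ⊕ e) ⊜ (x ⊕ d) ⊕ e) refl x (n · d) e) eq))
    where
    subtract : d ∣ˡ z → ∃[ x′ ] d ∙ x′ ≈ z × x ∣ˡ (n · x′)
    subtract (x′ , x′-eq) = x′ , x′-eq , (e , integral⇒cancelʳ P (Saturated.integral SP) (n · d)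
      (trans (solve 3 (λ x e d → (x ⊕ e) ⊕ d ⊜ (x ⊕ d) ⊕ e) refl x e (n · d))
        (trans eq (trans (×-congʳ n (trans (sym x′-eq) (comm d x′))) (×-distrib-+ x′ d n)))))

-- Here a₁, a₂ stand for elements of P, and q₂ + q = q₁ + a₁ says that q is the
-- translate of q₁ − q₂ which lies in Q.
module _ (Q : CommutativeMonoid c ℓ) (SQ : Saturated Q) (k : ℕ)
         (q₁ a₁ q₂ a₂ : CommutativeMonoid.Carrier Q) where
  open CommutativeMonoid Q
  open Mult Q using (×-congʳ; ×-distrib-+; ×-assocˡ) renaming (_×_ to _·_)
  open RawMonoidDefinitions rawMonoid using (_∣ˡ_)
  open SetoidReasoning setoid
  open Solver Q using (solve; _⊜_; _⊕_)
  private
    -- With M = k + 1, y₁ + k a₁ = M (q₁ + a₁): the summand k a₁ turns y₁ into a multiple of M.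
    M = suc k
    y₁ = M · q₁ ∙ a₁
    y₂ = M · q₂ ∙ a₂

  -- Once k a₁ is added to y₁, both q₂ and q₁ + a₁ occur with factor M, and saturation cancels it.
  translate-∣ : y₂ ∣ˡ y₁ → q₂ ∣ˡ (q₁ ∙ a₁)
  translate-∣ (w , eq) = ×-cancel-∣ Q SQ {M} (s≤s z≤n) ((a₂ ∙ w) ∙ k · a₁ , (begin
    M · q₂ ∙ ((a₂ ∙ w) ∙ k · a₁)
      ≈⟨ solve 4 (λ q a w b → q ⊕ ((a ⊕ w) ⊕ b) ⊜ ((q ⊕ a) ⊕ w) ⊕ b) refl (M · q₂) a₂ w (k · a₁) ⟩
    (y₂ ∙ w) ∙ k · a₁ ≈⟨ ∙-congʳ eq ⟩
    y₁ ∙ k · a₁       ≈⟨ assoc _ _ _ ⟩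
    M · q₁ ∙ M · a₁   ≈⟨ ×-distrib-+ q₁ a₁ M ⟨
    M · (q₁ ∙ a₁)     ∎))

  module _ {q} (q-eq : q₂ ∙ q ≈ q₁ ∙ a₁) where

    -- The identity y₁ - y₂ = M q - (a₂ + k a₁), written without subtraction. It underlies the next
    -- two lemmas.
    ×-translate : M · q ∙ M · q₂ ≈ y₁ ∙ k · a₁
    ×-translate = begin
      M · q ∙ M · q₂  ≈⟨ ×-distrib-+ q q₂ M ⟨
      M · (q ∙ q₂)    ≈⟨ ×-congʳ M (trans (comm q q₂) q-eq) ⟩
      M · (q₁ ∙ a₁)   ≈⟨ ×-distrib-+ q₁ a₁ M ⟩
      M · q₁ ∙ M · a₁ ≈⟨ assoc _ _ _ ⟨
      y₁ ∙ k · a₁     ∎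

    ∣-translate : ∀ n {x} → (x ∙ n · y₂) ∣ˡ (n · y₁) → (x ∙ n · (a₂ ∙ k · a₁)) ∣ˡ ((n ℕ.* M) · q)
    -- Adding n M q₂ to both sides lets `×-translate` apply without subtraction; integrality removes
    -- it again.
    ∣-translate n {x} (t , t-eq) = t , integral⇒cancelʳ Q (Saturated.integral SQ) (n · (M · q₂)) (begin
      ((x ∙ n · (a₂ ∙ k · a₁)) ∙ t) ∙ n · (M · q₂)
        ≈⟨ solve 4 (λ x d t q → ((x ⊕ d) ⊕ t) ⊕ q ⊜ (x ⊕ (d ⊕ q)) ⊕ t) refl
             x (n · (a₂ ∙ k · a₁)) t (n · (M · q₂)) ⟩
      (x ∙ (n · (a₂ ∙ k · a₁) ∙ n · (M · q₂))) ∙ t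
        ≈⟨ ∙-congʳ (∙-congˡ (×-distrib-+ _ _ n)) ⟨
      (x ∙ n · ((a₂ ∙ k · a₁) ∙ M · q₂)) ∙ t
        ≈⟨ ∙-congʳ (∙-congˡ (×-congʳ n
             (solve 3 (λ a b q → (a ⊕ b) ⊕ q ⊜ (q ⊕ a) ⊕ b) refl a₂ (k · a₁) (M · q₂)))) ⟩
      (x ∙ n · (y₂ ∙ k · a₁)) ∙ t
        ≈⟨ ∙-congʳ (∙-congˡ (×-distrib-+ _ _ n)) ⟩
      (x ∙ (n · y₂ ∙ n · (k · a₁))) ∙ t
        ≈⟨ solve 4 (λ x y b t → (x ⊕ (y ⊕ b)) ⊕ t ⊜ ((x ⊕ y) ⊕ t) ⊕ b) refl
             x (n · y₂) (n · (k · a₁)) t ⟩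
      ((x ∙ n · y₂) ∙ t) ∙ n · (k · a₁) ≈⟨ ∙-congʳ t-eq ⟩
      n · y₁ ∙ n · (k · a₁)             ≈⟨ ×-distrib-+ _ _ n ⟨
      n · (y₁ ∙ k · a₁)                 ≈⟨ ×-congʳ n ×-translate ⟨
      n · (M · q ∙ M · q₂)              ≈⟨ ×-distrib-+ _ _ n ⟩
      n · (M · q) ∙ n · (M · q₂)        ≈⟨ ∙-congʳ (×-assocˡ q n M) ⟩
      (n ℕ.* M) · q ∙ n · (M · q₂)      ∎)

    ∣-untranslate : ∀ {x} → ((a₂ ∙ k · a₁) ∙ x) ∣ˡ (M · q) → (x ∙ y₂) ∣ˡ y₁
    ∣-untranslate {x} (r , r-eq) = r , integral⇒cancelʳ Q (Saturated.integral SQ) (k · a₁) (begin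
      ((x ∙ y₂) ∙ r) ∙ k · a₁
        ≈⟨ solve 5 (λ x q a r b → ((x ⊕ (q ⊕ a)) ⊕ r) ⊕ b ⊜ (((a ⊕ b) ⊕ x) ⊕ r) ⊕ q) refl
             x (M · q₂) a₂ r (k · a₁) ⟩
      (((a₂ ∙ k · a₁) ∙ x) ∙ r) ∙ M · q₂ ≈⟨ ∙-congʳ r-eq ⟩
      M · q ∙ M · q₂                     ≈⟨ ×-translate ⟩
      y₁ ∙ k · a₁                        ∎)

-- The saturation of a monoid seen through a homomorphism.

module _ (P : CommutativeMonoid c₁ ℓ₁) (Q : CommutativeMonoid c₂ ℓ₂) (f : Hom P Q) where
  private
    module P = CommutativeMonoid P
    module Q = CommutativeMonoid Q
    module Pᵍ = AbelianGroup (P ᵍᵖ)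
    module Qᵍ = AbelianGroup (Q ᵍᵖ)
    module f = MonoidHomomorphism f
    module fᵍ = GroupHomomorphism (gpMap P Q f)
    open RawMonoidDefinitions Pᵍ.rawMonoid using () renaming (_×_ to _·ᵍ_)
    open RawMonoidDefinitions Q.rawMonoid using () renaming (_×_ to _·ꟴ_; _∣ˡ_ to _∣ꟴ_)
    module S = CommutativeMonoid (saturation P)
    module ι = MonoidHomomorphism (toSaturation P)
    open RawMonoidDefinitions S.rawMonoid using () renaming (_×_ to _·ˢ_; _∣ˡ_ to _∣ˢ_)

  gpMap-InSaturation : ∀ {a} → InSaturation P a → InSaturation Q fᵍ.⟦ a ⟧
  gpMap-InSaturation {a} (n , 1≤n , s , p) = n , 1≤n , f.⟦ s ⟧ ,
    Qᵍ.trans (Qᵍ.sym (homo-× Pᵍ.commutativeMonoid Qᵍ.commutativeMonoid fᵍ.monoidHomomorphism n a))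
      (Qᵍ.trans (fᵍ.⟦⟧-cong p)
        (Q.ε , Q.∙-congʳ (Q.∙-congˡ (Q.sym f.ε-homo))))

  -- The map of group envelopes carries the saturation of `P` into that of `Q`, which is `Q` itself.
  InSaturation⇒∣ : Saturated Q → ∀ {a b} → InSaturation P (a , b) → f.⟦ b ⟧ ∣ꟴ f.⟦ a ⟧
  InSaturation⇒∣ SQ s = saturation⇒∣ Q SQ (gpMap-InSaturation s)

  ×-cross : Integral Q → ∀ n a b c d → (c , d) Pᵍ.≈ (n ·ᵍ (a , b)) →
    f.⟦ c ⟧ Q.∙ n ·ꟴ f.⟦ b ⟧ Q.≈ n ·ꟴ f.⟦ a ⟧ Q.∙ f.⟦ d ⟧
  ×-cross integral n a b c d p = integral⇒cross Q integral
    (≡.subst (fᵍ.⟦ c , d ⟧ Qᵍ.≈_) (×-pair Q n f.⟦ a ⟧ f.⟦ b ⟧)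
      (Qᵍ.trans (fᵍ.⟦⟧-cong p)
        (homo-× Pᵍ.commutativeMonoid Qᵍ.commutativeMonoid fᵍ.monoidHomomorphism n (a , b))))

  -- The quotient is a difference c - d in the saturation, and f c - f d is an element t of `Q`;
  -- this t is the new quotient. Later `P` is the pushout and f takes numerators.
  toSaturation-∣ : Saturated Q → ∀ n x (s : S.Carrier) → ι.⟦ x ⟧ ∣ˢ (n ·ˢ s) →
    (f.⟦ x ⟧ Q.∙ n ·ꟴ f.⟦ proj₂ (proj₁ s) ⟧) ∣ꟴ (n ·ꟴ f.⟦ proj₁ (proj₁ s) ⟧)
  toSaturation-∣ SQ n x s@((a , b) , _) (((c , d) , t∈) , eq) =
    let t , t-eq = InSaturation⇒∣ SQ t∈ in
    t , integral⇒cancelʳ Q (Saturated.integral SQ) f.⟦ d ⟧ (begin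
      ((f.⟦ x ⟧ ∙ n ·ꟴ f.⟦ b ⟧) ∙ t) ∙ f.⟦ d ⟧
        ≈⟨ solve 4 (λ x b t d → ((x ⊕ b) ⊕ t) ⊕ d ⊜ (x ⊕ (d ⊕ t)) ⊕ b) Q.refl
             f.⟦ x ⟧ (n ·ꟴ f.⟦ b ⟧) t f.⟦ d ⟧ ⟩
      (f.⟦ x ⟧ ∙ (f.⟦ d ⟧ ∙ t)) ∙ n ·ꟴ f.⟦ b ⟧
        ≈⟨ Q.∙-congʳ (Q.∙-congˡ t-eq) ⟩
      (f.⟦ x ⟧ ∙ f.⟦ c ⟧) ∙ n ·ꟴ f.⟦ b ⟧
        ≈⟨ Q.∙-congʳ (f.homo x c) ⟨
      f.⟦ x P.∙ c ⟧ ∙ n ·ꟴ f.⟦ b ⟧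
        ≈⟨ ×-cross (Saturated.integral SQ) n a b (x P.∙ c) (P.ε P.∙ d)
             (≡.subst ((x P.∙ c , P.ε P.∙ d) Pᵍ.≈_) (saturation-× P n s) eq) ⟩
      n ·ꟴ f.⟦ a ⟧ ∙ f.⟦ P.ε P.∙ d ⟧
        ≈⟨ Q.∙-congˡ (f.⟦⟧-cong (P.identityˡ d)) ⟩
      n ·ꟴ f.⟦ a ⟧ ∙ f.⟦ d ⟧ ∎)
    where
    open Q using (_∙_)
    open SetoidReasoning Q.setoid
    open Solver Q using (solve; _⊜_; _⊕_)

  -- The hypothesis says that f detects the saturation. It is applied to s - x, the only possible
  -- quotient.
  ∣-toSaturation : (∀ a b → f.⟦ b ⟧ ∣ꟴ f.⟦ a ⟧ → InSaturation P (a , b)) →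
    ∀ x (s : S.Carrier) → (f.⟦ x ⟧ Q.∙ f.⟦ proj₂ (proj₁ s) ⟧) ∣ꟴ f.⟦ proj₁ (proj₁ s) ⟧ →
    ι.⟦ x ⟧ ∣ˢ s
  ∣-toSaturation ∣⇒InSaturation x ((a , b) , _) (r , r-eq) =
    (((a , b) Pᵍ.∙ (P.ε , x)) , ∣⇒InSaturation _ _ (r , difference)) ,
    Pᵍ.trans (Pᵍ.sym (Pᵍ.assoc (x , P.ε) (a , b) (P.ε , x)))
      (xyx⁻¹≈y (x , P.ε) (a , b))
    where
    open AbelianGroupProperties (P ᵍᵖ) using (xyx⁻¹≈y)
    difference : f.⟦ b P.∙ x ⟧ Q.∙ r Q.≈ f.⟦ a P.∙ P.ε ⟧
    difference = Q.trans (Q.∙-congʳ (Q.trans (f.homo b x) (Q.comm _ _)))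
      (Q.trans r-eq (f.⟦⟧-cong (P.sym (P.identityʳ a))))

-- The conductor condition for numerators.

module _ (P : CommutativeMonoid c₁ ℓ₁) (Q : CommutativeMonoid c₂ ℓ₂) (u : Hom P Q) where
  private
    module P = CommutativeMonoid P
    module Q = CommutativeMonoid Q
    module u = MonoidHomomorphism u
    open RawMonoidDefinitions P.rawMonoid using ()
      renaming (_×_ to _·ᴾ_; _∣ˡ_ to _∣ᴾ_)
    open RawMonoidDefinitions Q.rawMonoid using ()
      renaming (_×_ to _·ꟴ_; _∣ˡ_ to _∣ꟴ_)

  -- This is quasi-saturation with each fraction replaced by its numerator, so that divisibility is
  -- tested in `Q`.
  conductor⇒dominates : Saturated P → Saturated Q → ∀ {M} → 1 ≤ M → HasConductor P Q u M →
    ∀ {n} → 1 ≤ n → ∀ x q₁ p₁ q₂ p₂ →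
    (u.⟦ x ⟧ Q.∙ n ·ꟴ (M ·ꟴ q₂ Q.∙ u.⟦ p₂ ⟧)) ∣ꟴ (n ·ꟴ (M ·ꟴ q₁ Q.∙ u.⟦ p₁ ⟧)) →
    ∃[ x′ ] x ∣ᴾ (n ·ᴾ x′) × (u.⟦ x′ ⟧ Q.∙ (M ·ꟴ q₂ Q.∙ u.⟦ p₂ ⟧)) ∣ꟴ (M ·ꟴ q₁ Q.∙ u.⟦ p₁ ⟧)
  conductor⇒dominates SP SQ {M@(suc k)} 1≤M conductor {n} 1≤n x q₁ p₁ q₂ p₂ x∣ny@(t , t-eq) =
    translated (translate-∣ Q SQ k q₁ a₁ q₂ a₂ y₂∣y₁)
    where
    open Solver Q using (solve; _⊜_; _⊕_)
    a₁ = u.⟦ p₁ ⟧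
    a₂ = u.⟦ p₂ ⟧
    y₁ = M ·ꟴ q₁ Q.∙ a₁
    y₂ = M ·ꟴ q₂ Q.∙ a₂
    -- Moving p₁ into q changes the `P`-part p₁ - p₂ to p₁ - p₂ - M p₁ = -d.
    d = p₂ P.∙ k ·ᴾ p₁

    Dominated : Set _
    Dominated = ∃[ x′ ] x ∣ᴾ (n ·ᴾ x′) × (u.⟦ x′ ⟧ Q.∙ y₂) ∣ꟴ y₁

    -- The hypothesis contains n y₂ ∣ n y₁, with quotient u x + t.
    y₂∣y₁ : y₂ ∣ꟴ y₁
    y₂∣y₁ = ×-cancel-∣ Q SQ 1≤n (u.⟦ x ⟧ Q.∙ t ,
      Q.trans (solve 3 (λ x y t → y ⊕ (x ⊕ t) ⊜ (x ⊕ y) ⊕ t) Q.refl u.⟦ x ⟧ (n ·ꟴ y₂) t) t-eq)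

    u-d : u.⟦ d ⟧ Q.≈ a₂ Q.∙ k ·ꟴ a₁
    u-d = Q.trans (u.homo p₂ _) (Q.∙-congˡ (homo-× P Q u k p₁))

    u-X : u.⟦ x P.∙ n ·ᴾ d ⟧ Q.≈ u.⟦ x ⟧ Q.∙ n ·ꟴ (a₂ Q.∙ k ·ꟴ a₁)
    u-X = Q.trans (u.homo x _) (Q.∙-congˡ (Q.trans (homo-× P Q u n d) (Mult.×-congʳ Q n u-d)))

    module _ {q} (q-eq : q₂ Q.∙ q Q.≈ q₁ Q.∙ a₁) where

      subtracted : ∀ {z} → u.⟦ z ⟧ ∣ꟴ (M ·ꟴ q) →
        ∃[ x′ ] d P.∙ x′ P.≈ z × x ∣ᴾ (n ·ᴾ x′) → Dominated
      subtracted (r , r-eq) (x′ , x′-eq , x∣nx′) = x′ , x∣nx′ ,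
        ∣-untranslate Q SQ k q₁ a₁ q₂ a₂ q-eq (r ,
          Q.trans (Q.∙-congʳ (Q.trans (Q.∙-congʳ (Q.sym u-d))
            (Q.trans (Q.sym (u.homo d x′)) (u.⟦⟧-cong x′-eq)))) r-eq)

      conducted : (∃[ z ] (M ·ᴾ (x P.∙ n ·ᴾ d)) ∣ᴾ ((n ℕ.* M) ·ᴾ z) × u.⟦ z ⟧ ∣ꟴ (M ·ꟴ q)) → Dominated
      -- Cancelling M leaves x + n d ∣ n z, and subtracting d from z gives x′.
      conducted (z , MX∣nMz , z∣Mq) = subtracted z∣Mq
        (×-subtract P SP 1≤n (×-cancel-∣-* P SP {M} {n} {z} {x P.∙ n ·ᴾ d} 1≤M MX∣nMz))

      X∣nMq : u.⟦ x P.∙ n ·ᴾ d ⟧ ∣ꟴ ((n ℕ.* M) ·ꟴ q)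
      X∣nMq = let t , t-eq = ∣-translate Q SQ k q₁ a₁ q₂ a₂ q-eq n x∣ny in
        t , Q.trans (Q.∙-congʳ u-X) t-eq

    translated : q₂ ∣ꟴ (q₁ Q.∙ a₁) → Dominated
    translated (q , q-eq) = conducted q-eq
      -- The multiplier is n M because x + n d divides n M q, while the conductor is applied to q
      -- and not to M q.
      (conductor (n ℕ.* M) (ℕₚ.*-mono-≤ 1≤n 1≤M) (x P.∙ n ·ᴾ d) q (X∣nMq q-eq))

  -- Numerators in the pushout and divisibility in its saturation.

  module _ (m : ℕ) where
    private
      Push = pushout P Q (1/ m ∙ P) u (toFraction m P)
      module Push = CommutativeMonoid Push
      module Pushᵍ = AbelianGroup (Push ᵍᵖ)
      module MQ = Mult Q
      open RawMonoidDefinitions Push.rawMonoid using () renaming (_×_ to _·ᶠ_)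
      open CommutativeSemigroupProperties Q.commutativeSemigroup using (interchange)

    -- (q , p) represents q + p/m = (m q + u p)/m.
    numerator : Push.Carrier → Q.Carrier
    numerator (q , p) = m ·ꟴ q Q.∙ u.⟦ p ⟧

    private
      m·ε≈ε : m ·ꟴ Q.ε Q.≈ Q.ε
      m·ε≈ε = MonoidHomomorphism.ε-homo (toFraction m Q)

      numerator-homo : ∀ a b → numerator (a Push.∙ b) Q.≈ numerator a Q.∙ numerator b
      numerator-homo (q , p) (q′ , p′) =
        Q.trans (Q.∙-cong (MQ.×-distrib-+ q q′ m) (u.homo p p′)) (interchange _ _ _ _)

      numerator-cong : ∀ {a b} → a Push.≈ b → numerator a Q.≈ numerator b
      numerator-cong (incl (p , q)) = Q.∙-cong (MQ.×-congʳ m p) (u.⟦⟧-cong q)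
      -- The glued elements have numerators m (u p) and u (m p): the factor m on q matches the one
      -- in `toFraction`.
      numerator-cong (glue p) = Q.trans (Q.∙-congˡ u.ε-homo) (Q.trans (Q.identityʳ _)
        (Q.sym (Q.trans (Q.∙-congʳ m·ε≈ε) (Q.trans (Q.identityˡ _) (homo-× P Q u m p)))))
      numerator-cong (symᵖ p) = Q.sym (numerator-cong p)
      numerator-cong (transᵖ p q) = Q.trans (numerator-cong p) (numerator-cong q)
      numerator-cong (congᵖ p q) = Q.trans (numerator-homo _ _)
        (Q.trans (Q.∙-cong (numerator-cong p) (numerator-cong q)) (Q.sym (numerator-homo _ _)))

    numeratorHom : Hom (pushout P Q (1/ m ∙ P) u (toFraction m P)) Q
    numeratorHom = record
      { ⟦_⟧ = numerator
      ; isMonoidHomomorphism = record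
        { isMagmaHomomorphism = record
          { isRelHomomorphism = record { cong = numerator-cong }
          ; homo = numerator-homo
          }
        ; ε-homo = Q.trans (Q.∙-cong m·ε≈ε u.ε-homo) (Q.identityʳ Q.ε)
        }
      }

    private
      ×-components : ∀ n q p → n ·ᶠ (q , p) ≡ (n ·ꟴ q , n ·ᴾ p)
      ×-components zero    q p = ≡.refl
      ×-components (suc n) q p = ≡.cong ((q , p) Push.∙_) (×-components n q p)

    numerator-right : ∀ p → numerator (Q.ε , p) Q.≈ u.⟦ p ⟧
    numerator-right p = Q.trans (Q.∙-congʳ m·ε≈ε) (Q.identityˡ _)

    -- The multiple is (m q, m p), and gluing moves m p to the left component as u p.
    m×≈numerator : ∀ a → m ·ᶠ a Push.≈ (numerator a , P.ε)
    m×≈numerator (q , p) = ≡.subst (Push._≈ (numerator (q , p) , P.ε)) (≡.sym (×-components m q p))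
      (Push.trans (incl (Q.sym (Q.identityʳ _) , P.sym (P.identityˡ _)))
        (Push.trans (congᵖ (incl (Q.refl , P.refl)) (symᵖ (glue p)))
          (incl (Q.refl , P.identityʳ P.ε))))

    -- By `m×≈numerator`, m (a - b) is the difference of the numerators, which is the image of r;
    -- hence m itself is the witness.
    numerator-∣⇒InSaturation : 1 ≤ m → ∀ a b → numerator b ∣ꟴ numerator a →
      InSaturation (pushout P Q (1/ m ∙ P) u (toFraction m P)) (a , b)
    numerator-∣⇒InSaturation 1≤m a b (r , eq) = m , 1≤m , (r , P.ε) ,
      ≡.subst (Pushᵍ._≈ ((r , P.ε) , Push.ε)) (≡.sym (×-pair Push m a b))
        (Push.ε , Push.∙-congʳ (Push.trans (Push.identityʳ _)
          (Push.trans (m×≈numerator a)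
            (Push.trans (incl (Q.trans (Q.sym eq) (Q.comm _ r) , P.sym (P.identityʳ _)))
              (Push.∙-congˡ {r , P.ε} (Push.sym (m×≈numerator b)))))))

    private
      module ι = MonoidHomomorphism (satPushoutInjʳ P Q (1/ m ∙ P) u (toFraction m P))
      open RawMonoidDefinitions (CommutativeMonoid.rawMonoid (satPushout P Q (1/ m ∙ P) u (toFraction m P)))
        using () renaming (_×_ to _·ˢ_; _∣ˡ_ to _∣ˢ_)

    satPushoutInjʳ-∣ : Saturated Q → ∀ n x s → ι.⟦ x ⟧ ∣ˢ (n ·ˢ s) →
      (u.⟦ x ⟧ Q.∙ n ·ꟴ numerator (proj₂ (proj₁ s))) ∣ꟴ (n ·ꟴ numerator (proj₁ (proj₁ s)))
    satPushoutInjʳ-∣ SQ n x s x∣ns =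
      let t , t-eq = toSaturation-∣ (pushout P Q (1/ m ∙ P) u (toFraction m P)) Q numeratorHom
                       SQ n (Q.ε , x) s x∣ns
      in t , Q.trans (Q.∙-congʳ (Q.∙-congʳ (Q.sym (numerator-right x)))) t-eq

    ∣-satPushoutInjʳ : 1 ≤ m → ∀ x s →
      (u.⟦ x ⟧ Q.∙ numerator (proj₂ (proj₁ s))) ∣ꟴ numerator (proj₁ (proj₁ s)) → ι.⟦ x ⟧ ∣ˢ s
    ∣-satPushoutInjʳ 1≤m x s (r , r-eq) =
      ∣-toSaturation (pushout P Q (1/ m ∙ P) u (toFraction m P)) Q numeratorHom
        (numerator-∣⇒InSaturation 1≤m) (Q.ε , x) s
        (r , Q.trans (Q.∙-congʳ (Q.∙-congʳ (numerator-right x))) r-eq)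

  conductor⇒quasiSaturated : Saturated P → Saturated Q → ∀ {M} → 1 ≤ M → HasConductor P Q u M →
    QuasiSaturated (1/ M ∙ P)
      (satPushout P Q (1/ M ∙ P) u (toFraction M P))
      (satPushoutInjʳ P Q (1/ M ∙ P) u (toFraction M P))
  conductor⇒quasiSaturated SP SQ {M} 1≤M conductor n 1≤n x s x∣ns =
    let x′ , (e , e-eq) , x′∣s = conductor⇒dominates SP SQ 1≤M conductor 1≤n x
          (proj₁ (proj₁ (proj₁ s))) (proj₂ (proj₁ (proj₁ s)))
          (proj₁ (proj₂ (proj₁ s))) (proj₂ (proj₂ (proj₁ s))) (satPushoutInjʳ-∣ M SQ n x s x∣ns)
    -- Conductor 1 involves the multiples `1 · x` and `1 · s`, which unfold to sums with the
    -- identity.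
    in x′ , (e , P.trans (P.∙-congʳ (P.identityʳ x)) e-eq) ,
       ∣-1× (satPushout P Q (1/ M ∙ P) u (toFraction M P)) _ s (∣-satPushoutInjʳ M 1≤M x′ s x′∣s)

proposition1p4 : ∀ {c₁ ℓ₁ c₂ ℓ₂}
    (Q : CommutativeMonoid c₂ ℓ₂) (P : CommutativeMonoid c₁ ℓ₁)
    (u : Hom P Q) →
    TorsionFree Q → Fs Q → Toric P →
    Injective (CommutativeMonoid._≈_ P) (CommutativeMonoid._≈_ Q) (MonoidHomomorphism.⟦_⟧ u) →
    MeetsNegativeTrivially P Q u →
    PseudoSaturated P Q u →
    TorsionFreeGroup (cokernel (P ᵍᵖ) (Q ᵍᵖ) (gpMap P Q u)) →
    ∃[ m ] 1 ≤ m ×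
    QuasiSaturated (1/ m ∙ P)
    (satPushout P Q (1/ m ∙ P) u (toFraction m P))
    (satPushoutInjʳ P Q (1/ m ∙ P) u (toFraction m P))
proposition1p4 Q P u _ fsQ toricP _ _ (M , 1≤M , conductor) _ =
  M , 1≤M , conductor⇒quasiSaturated P Q u
    (Fs.isSaturated (Toric.fs toricP)) (Fs.isSaturated fsQ) 1≤M conductor
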